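{- Let $p\in\mathbf{Z}_{>0}$. (i) The fiber of the conumerator above $p$ is $$\mathrm{con}^{ -1}(p)=\bigl\{J(p/q)\;:\; q\in\mathbf{Z}_{>0},\ \gcd(p,q)=1\bigr\}.$$ (ii) The number of orbits of the map $x\mapsto \frac{1}{1+x}$ inside $\mathrm{con}^{ -1}(p)$ equals $\phi(p)$, where $\phi$ is Euler's totient function.
   Context: The conumerator $\mathrm{con}:\mathbf{Q}_{>0}\to\mathbf{Z}_{>0}$ is the unique function with $\mathrm{con}(1)=1$ satisfying, for all $x\in\mathbf{Q}_{>0}$, $\mathrm{con}(1+x)=\mathrm{con}(x)+\mathrm{con}(1/x)$ and $\mathrm{con}\left(\frac{1}{1+x}\right)=\mathrm{con}(x)$; in particular each fiber of $\mathrm{con}$ is mapped into itself by $x\mapsto\frac1{1+x}$. The function $J$ ("Jimm") is $J:\mathbf{Q}_{>0}\to\mathbf{Q}_{>0}$, $J(x):=\mathrm{con}(x)/\mathrm{con}(1/x)$. Orbits of the map $T(x)=\frac{1}{1+x}$ are the classes of the equivalence relation in which $x\sim y$ iff $y=T^k(x)$ or $x=T^k(y)$ for some integer $k\ge 0$ ($T$ is injective on $\mathbf{Q}_{>0}$). -}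

module Defs where

open import Algebra.Bundles using (module AbelianGroup)
import Algebra.Properties.Group as GroupProperties
open import Data.Integer.Base as ℤ using (+_; +[1+_])
open import Data.List.Base using (length; filter; applyUpTo)
open import Data.Nat.Base as ℕ
  using (ℕ; zero; suc; NonZero; _≤_; s≤s; compare; less; equal; greater)
open import Data.Nat.Coprimality using (Coprime; coprime?; coprime-+)
import Data.Nat.Properties as ℕ
open import Data.Product.Base using (∃; _,_; proj₁)
open import Data.Rational.Base as ℚ using (ℚ; mkℚ; 1ℚ)
import Data.Rational.Properties as ℚ
open import Data.Rational.Unnormalised.Base using (*≡*)
import Data.Rational.Unnormalised.Properties as ℚᵘ
open import Data.Sum.Base using (_⊎_; inj₁; inj₂; swap)
import Function.Endo.Propositional as Endo
open import Level using (0ℓ)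
open import Relation.Binary.Bundles using (Setoid)
import Relation.Binary.Construct.On as On
open import Relation.Binary.PropositionalEquality
  using (_≡_; refl; sym; trans; cong; cong₂; cong-app; subst)
open import Relation.Unary using (Pred)

-- The positivity proofs are irrelevant, so propositional equality on
-- these types is equality of the underlying numbers.

record ℕ⁺ : Set where
  constructor mkℕ⁺
  field
    ⟦_⟧ : ℕ
    .{{nonZero}} : NonZero ⟦_⟧

open ℕ⁺ public using (⟦_⟧)

record ℚ⁺ : Set where
  constructor mkℚ⁺
  field
    value : ℚ
    .{{positive}} : ℚ.Positive value

infixl 6 _+ℕ⁺_ _+_
infixl 7 _/_
infix  8 1/_

_+ℕ⁺_ : ℕ⁺ → ℕ⁺ → ℕ⁺
mkℕ⁺ m +ℕ⁺ mkℕ⁺ n = mkℕ⁺ (m ℕ.+ n) {{nonZero-+ m}}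
  where
  nonZero-+ : ∀ m {n} .{{_ : NonZero m}} → NonZero (m ℕ.+ n)
  nonZero-+ (suc _) = _

1ℚ⁺ : ℚ⁺
1ℚ⁺ = mkℚ⁺ 1ℚ

_+_ : ℚ⁺ → ℚ⁺ → ℚ⁺
mkℚ⁺ x + mkℚ⁺ y = mkℚ⁺ (x ℚ.+ y) {{ℚ.pos+pos⇒pos x y}}

1/_ : ℚ⁺ → ℚ⁺
1/ mkℚ⁺ x = mkℚ⁺ (ℚ.1/_ x {{ℚ.pos⇒nonZero x}}) {{ℚ.1/pos⇒pos x}}

_/_ : ℕ⁺ → ℕ⁺ → ℚ⁺
mkℕ⁺ m / mkℕ⁺ n = mkℚ⁺ ((+ m) ℚ./ n) {{ℚ.normalize-pos m n}}

-- These equations determine con uniquely (by the Euclidean algorithm);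
-- a solution is constructed in conumerator-exists below.

record IsConumerator (con : ℚ⁺ → ℕ⁺) : Set where
  field
    con-1       : con 1ℚ⁺ ≡ mkℕ⁺ 1
    con-1+x     : ∀ x → con (1ℚ⁺ + x) ≡ con x +ℕ⁺ con (1/ x)
    con-1/[1+x] : ∀ x → con (1/ (1ℚ⁺ + x)) ≡ con x

J : (ℚ⁺ → ℕ⁺) → ℚ⁺ → ℚ⁺
J con x = con x / con (1/ x)

T : ℚ⁺ → ℚ⁺
T x = 1/ (1ℚ⁺ + x)

Fiber : (ℚ⁺ → ℕ⁺) → ℕ⁺ → Pred ℚ⁺ 0ℓ
Fiber con p x = con x ≡ p

open Endo ℚ⁺ using (_^_; ^-homo)

infix 4 _∼_

_∼_ : ℚ⁺ → ℚ⁺ → Set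
x ∼ y = ∃ λ k → y ≡ (T ^ k) x ⊎ x ≡ (T ^ k) y

φ : ℕ → ℕ
φ n = length (filter (λ k → coprime? k n) (applyUpTo suc n))

value-injective : ∀ {x y} → ℚ⁺.value x ≡ ℚ⁺.value y → x ≡ y
value-injective refl = refl

1/-involutive : ∀ x → 1/ (1/ x) ≡ x
1/-involutive (mkℚ⁺ x) =
  value-injective (ℚ.1/-involutive x {{ℚ.pos⇒nonZero x}})

T-injective : ∀ {x y} → T x ≡ T y → x ≡ y
T-injective {x} {y} Tx≡Ty = value-injective
  (∙-cancelˡ 1ℚ _ _ (cong ℚ⁺.value 1+x≡1+y))
  where
  open GroupProperties (AbelianGroup.group ℚ.+-0-abelianGroup)
    using (∙-cancelˡ)
  1+x≡1+y : 1ℚ⁺ + x ≡ 1ℚ⁺ + y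
  1+x≡1+y = trans (sym (1/-involutive _))
                  (trans (cong 1/_ Tx≡Ty) (1/-involutive _))

∼-refl : ∀ {x} → x ∼ x
∼-refl = 0 , inj₁ refl

∼-sym : ∀ {x y} → x ∼ y → y ∼ x
∼-sym (k , e) = k , swap e

∼-merge : ∀ k l {x y} → (T ^ k) x ≡ (T ^ l) y → x ∼ y
∼-merge zero    l       eq = l , inj₂ eq
∼-merge (suc k) zero    eq = suc k , inj₁ (sym eq)
∼-merge (suc k) (suc l) eq = ∼-merge k l (T-injective eq)

T^-+ : ∀ k l x → (T ^ (k ℕ.+ l)) x ≡ (T ^ k) ((T ^ l) x)
T^-+ k l = cong-app (^-homo T k l)

∼-branch : ∀ k l x → (T ^ k) x ∼ (T ^ l) x
∼-branch k l x = ∼-merge l k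
  (trans (sym (T^-+ l k x))
         (trans (cong (λ m → (T ^ m) x) (ℕ.+-comm l k)) (T^-+ k l x)))

∼-trans : ∀ {x y z} → x ∼ y → y ∼ z → x ∼ z
∼-trans {x} (k , inj₁ refl) (l , inj₁ refl) = l ℕ.+ k , inj₁ (sym (T^-+ l k x))
∼-trans     (k , inj₁ refl) (l , inj₂ eq)   = ∼-merge k l eq
∼-trans {y = y} (k , inj₂ refl) (l , inj₁ refl) = ∼-branch k l y
∼-trans {z = z} (k , inj₂ refl) (l , inj₂ refl) = k ℕ.+ l , inj₂ (sym (T^-+ k l z))

∼-setoid : Setoid 0ℓ 0ℓ
∼-setoid = record
  { _≈_ = _∼_
  ; isEquivalence = record { refl = ∼-refl ; sym = ∼-sym ; trans = ∼-trans }
  }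

-- The fiber above p modulo ∼; its ≈-classes are the T-orbits inside it.

FiberOrbits : (ℚ⁺ → ℕ⁺) → ℕ⁺ → Setoid 0ℓ 0ℓ
FiberOrbits con p = On.setoid ∼-setoid (proj₁ {B = Fiber con p})

-- euclid f m n is con ((1 + m) / (1 + n)), provided the fuel f exceeds
-- m + n.

euclid : ℕ → ℕ → ℕ → ℕ⁺
euclid zero    _ _ = mkℕ⁺ 1
euclid (suc f) m n with compare m n
... | less    m k = euclid f k m
... | equal   m   = mkℕ⁺ 1
... | greater n k = euclid f k n +ℕ⁺ euclid f n k

compare-less : ∀ m k → compare m (suc (m ℕ.+ k)) ≡ less m k
compare-less zero    k = refl
compare-less (suc m) k rewrite compare-less m k = refl

compare-greater : ∀ n k → compare (suc (n ℕ.+ k)) n ≡ greater n k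
compare-greater zero    k = refl
compare-greater (suc n) k rewrite compare-greater n k = refl

+-comm-< : ∀ m n {h} → m ℕ.+ n ℕ.< h → n ℕ.+ m ℕ.< h
+-comm-< m n {h} = subst (ℕ._< h) (ℕ.+-comm m n)

euclid-fuel : ∀ {f g} m n → m ℕ.+ n ℕ.< f → m ℕ.+ n ℕ.< g →
              euclid f m n ≡ euclid g m n
euclid-fuel {suc f} {suc g} m n (s≤s p) (s≤s q) with compare m n
... | less m k    = euclid-fuel k m (smaller p) (smaller q)
  where
  smaller : ∀ {h} → m ℕ.+ suc (m ℕ.+ k) ≤ h → k ℕ.+ m ℕ.< h
  smaller le = +-comm-< m k (ℕ.≤-trans (ℕ.m≤n+m _ m) le)
... | equal m     = refl
... | greater n k = cong₂ _+ℕ⁺_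
  (euclid-fuel k n (smaller₁ p) (smaller₁ q))
  (euclid-fuel n k (smaller₂ p) (smaller₂ q))
  where
  smaller₂ : ∀ {h} → suc (n ℕ.+ k) ℕ.+ n ≤ h → n ℕ.+ k ℕ.< h
  smaller₂ = ℕ.≤-trans (ℕ.m≤m+n _ n)
  smaller₁ : ∀ {h} → suc (n ℕ.+ k) ℕ.+ n ≤ h → k ℕ.+ n ℕ.< h
  smaller₁ le = +-comm-< n k (smaller₂ le)

euclidean-con : ℚ⁺ → ℕ⁺
euclidean-con (mkℚ⁺ (mkℚ num n _)) = euclid (suc (m ℕ.+ n)) m n
  where
  m : ℕ
  m = ℕ.pred ℤ.∣ num ∣

positive-elim : (P : ℚ⁺ → Set) →
                (∀ m n .(c : Coprime (suc m) (suc n)) → P (mkℚ⁺ (mkℚ +[1+ m ] n c))) →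
                ∀ x → P x
positive-elim P f (mkℚ⁺ (mkℚ +[1+ m ] n c)) = f m n c

coprime-1+ : ∀ {m n} → Coprime (suc m) (suc n) →
             Coprime (suc (suc (n ℕ.+ m))) (suc n)
coprime-1+ {m} {n} c =
  subst (λ k → Coprime (suc k) (suc n)) (ℕ.+-suc n m) (coprime-+ c)

1+mkℚ : ∀ m n .(c : Coprime (suc m) (suc n)) →
        1ℚ⁺ + mkℚ⁺ (mkℚ +[1+ m ] n c) ≡
        mkℚ⁺ (mkℚ +[1+ suc (n ℕ.+ m) ] n (coprime-1+ c))
1+mkℚ m n c = value-injective (ℚ.toℚᵘ-injective
  (ℚᵘ.≃-trans (ℚ.toℚᵘ-homo-+ 1ℚ (mkℚ +[1+ m ] n c)) (*≡* (cong +_ eq))))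
  where
  eq : (1 ℕ.* suc n ℕ.+ suc m ℕ.* 1) ℕ.* suc n ≡ suc (suc (n ℕ.+ m)) ℕ.* (1 ℕ.* suc n)
  eq = cong₂ ℕ._*_
    (trans (cong₂ ℕ._+_ (ℕ.*-identityˡ (suc n)) (ℕ.*-identityʳ (suc m)))
           (cong suc (ℕ.+-suc n m)))
    (sym (ℕ.*-identityˡ (suc n)))

euclid-less : ∀ m k → euclid (suc (m ℕ.+ suc (m ℕ.+ k))) m (suc (m ℕ.+ k)) ≡
                      euclid (suc (k ℕ.+ m)) k m
euclid-less m k rewrite compare-less m k =
  euclid-fuel k m fuel (ℕ.n<1+n _)
  where
  fuel : k ℕ.+ m ℕ.< m ℕ.+ suc (m ℕ.+ k)
  fuel = +-comm-< m k (ℕ.m≤n+m _ m)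

euclid-greater : ∀ n k → euclid (suc (suc (n ℕ.+ k) ℕ.+ n)) (suc (n ℕ.+ k)) n ≡
                         euclid (suc (k ℕ.+ n)) k n +ℕ⁺ euclid (suc (n ℕ.+ k)) n k
euclid-greater n k rewrite compare-greater n k = cong₂ _+ℕ⁺_
  (euclid-fuel k n (+-comm-< n k fuel) (ℕ.n<1+n _))
  (euclid-fuel n k fuel (ℕ.n<1+n _))
  where
  fuel : n ℕ.+ k ℕ.< suc (n ℕ.+ k) ℕ.+ n
  fuel = ℕ.m≤m+n _ n

conumerator-exists : ∃ IsConumerator
conumerator-exists = euclidean-con , record
  { con-1       = refl
  ; con-1+x     = positive-elim _ λ m n c →
      trans (cong euclidean-con (1+mkℚ m n c)) (euclid-greater n m)
  ; con-1/[1+x] = positive-elim _ λ m n c →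
      trans (cong (λ x → euclidean-con (1/ x)) (1+mkℚ m n c)) (euclid-less n m)
  }

-- Write con x / con (1/x) = J x. By induction along 1, 1 + x and 1/x, this
-- fraction is in lowest terms and J is an involution, so
-- x ↦ (con x , con (1/x)) is a bijection onto the coprime pairs; this is (i).
-- In these coordinates T is (p , q) ↦ (p , p + q), so the orbits in the fiber
-- above p are the residues q mod p that are coprime to p; this is (ii).

{-# OPTIONS --safe #-}
module Submission where

open import Defs
import Algebra.Properties.CommutativeSemigroup as CommutativeSemigroup
open import Data.Fin.Base using (Fin; zero; suc)
open import Data.Integer.Base using (+[1+_])
open import Data.List.Base using (List; length; lookup; filter; applyUpTo)
open import Data.List.Membership.Propositional using (_∈_)
open import Data.List.Membership.Propositional.Properties
  using (∈-lookup; ∈-filter⁺; ∈-filter⁻; ∈-applyUpTo⁺; ∈-applyUpTo⁻)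
import Data.List.Relation.Unary.All as All
open import Data.List.Relation.Unary.AllPairs using (_∷_)
open import Data.List.Relation.Unary.Any using (index)
open import Data.List.Relation.Unary.Any.Properties using (lookup-index)
open import Data.List.Relation.Unary.Unique.Propositional using (Unique)
open import Data.List.Relation.Unary.Unique.Propositional.Properties
  using (filter⁺; applyUpTo⁺₁)
open import Data.Nat.Base as ℕ
  using (ℕ; zero; suc; _<_; compare; less; equal; greater)
open import Data.Nat.Coprimality as Coprimality
  using (Coprime; coprime?; coprime-+; coprime⇒gcd≡1; gcd≡1⇒coprime; 1-coprimeTo)
open import Data.Nat.Divisibility using (_∣_; ∣-refl; ∣-trans; ∣m∣n⇒∣m+n; n∣m*n)
open import Data.Nat.DivMod
  using (_%_; m≡m%n+[m/n]*n; [m+kn]%n≡m%n; m%n<n; m<n⇒m%n≡m)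
open import Data.Nat.GCD using (gcd)
open import Data.Nat.Induction using (Acc; acc; <-wellFounded)
import Data.Nat.Properties as ℕ
open import Data.Product.Base using (_×_; _,_; ∃-syntax; proj₁)
open import Data.Rational.Base using (mkℚ)
import Data.Rational.Properties as ℚ
open import Data.Sum.Base using (inj₁; inj₂)
open import Function.Bundles using (Bijection)
import Function.Endo.Propositional as Endo
open import Level using (Level)
open import Relation.Binary.Bundles using (Setoid)
open import Relation.Binary.PropositionalEquality
  using (_≡_; refl; sym; trans; cong; cong₂; subst; subst₂; setoid; module ≡-Reasoning)
open import Relation.Nullary using (contradiction)
open import Relation.Unary using (_≐_)

open Endo ℚ⁺ using (_^_)
open CommutativeSemigroup ℕ.+-commutativeSemigroup using (x∙yz≈y∙xz)
open ≡-Reasoning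

private variable
  a ℓ : Level

-- Setoids classified by a duplicate-free list

lookup-injective : {A : Set a} {xs : List A} → Unique xs →
                   ∀ i j → lookup xs i ≡ lookup xs j → i ≡ j
lookup-injective (x∉ ∷ u) zero    zero    eq = refl
lookup-injective (x∉ ∷ u) zero    (suc j) eq = contradiction eq (All.lookup x∉ (∈-lookup j))
lookup-injective (x∉ ∷ u) (suc i) zero    eq = contradiction (sym eq) (All.lookup x∉ (∈-lookup i))
lookup-injective (x∉ ∷ u) (suc i) (suc j) eq = cong suc (lookup-injective u i j eq)

module _ (S : Setoid a ℓ) {B : Set a} {xs : List B} (unique : Unique xs) where

  open Setoid S using (Carrier; _≈_)

  -- A complete invariant `f` sends each class to the position of its value in `xs`. Since `xs` has
  -- no repetitions, the value determines the position, so equality of values and equality of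
  -- positions agree.
  classified-by-unique-list : (f : Carrier → B) (f∈ : ∀ x → f x ∈ xs) →
    (∀ x y → x ≈ y → f x ≡ f y) → (∀ x y → f x ≡ f y → x ≈ y) →
    (∀ {b} → b ∈ xs → ∃[ x ] f x ≡ b) → Bijection S (setoid (Fin (length xs)))
  classified-by-unique-list f f∈ f-cong f-injective f-surjective = record
    { to        = to
    ; cong      = λ {x} {y} x≈y → to-≡ _ (trans (f-cong x y x≈y) (lookup-to y))
    ; bijective =
        (λ {x} {y} eq → f-injective x y (trans (lookup-to x)
          (trans (cong (lookup xs) eq) (sym (lookup-to y)))))
      , λ i → let (x , fx≡) = f-surjective (∈-lookup i) in
          x , λ {z} z≈x → to-≡ i (trans (f-cong z x z≈x) fx≡)
    }
    where
    to : Carrier → Fin (length xs)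
    to x = index (f∈ x)

    lookup-to : ∀ x → f x ≡ lookup xs (to x)
    lookup-to x = lookup-index (f∈ x)

    to-≡ : ∀ {x} i → f x ≡ lookup xs i → to x ≡ i
    to-≡ {x} i eq = lookup-injective unique (to x) i (trans (sym (lookup-to x)) eq)

-- Coprimality, Euclidean induction and reduced fractions

coprime-∣+ : ∀ {l m n} → n ∣ l → Coprime (l ℕ.+ m) n → Coprime m n
coprime-∣+ n∣l c (d∣m , d∣n) = c (∣m∣n⇒∣m+n (∣-trans d∣n n∣l) d∣m , d∣n)

coprime-1+⁻ : ∀ {m n} → Coprime (suc (suc (n ℕ.+ m))) (suc n) → Coprime (suc m) (suc n)
coprime-1+⁻ {m} {n} c =
  coprime-∣+ ∣-refl (subst (λ k → Coprime (suc k) (suc n)) (sym (ℕ.+-suc n m)) c)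

-- This is the subtractive Euclidean algorithm. It terminates because `m ℕ.+ n` decreases, where the
-- fraction is (1 + m) / (1 + n).
ℚ⁺-induction : (P : ℚ⁺ → Set) → P 1ℚ⁺ → (∀ x → P x → P (1ℚ⁺ + x)) →
               (∀ x → P x → P (1/ x)) → ∀ x → P x
ℚ⁺-induction P base step inv = positive-elim P λ m n → go m n (<-wellFounded _)
  where
  go : ∀ m n → Acc _<_ (m ℕ.+ n) → .(c : Coprime (suc m) (suc n)) →
       P (mkℚ⁺ (mkℚ +[1+ m ] n c))
  go m n (acc rs) c with compare m n
  ... | greater n k = subst P (1+mkℚ k n (coprime-1+⁻ c))
    (step _ (go k n (rs (+-comm-< n k (ℕ.m≤m+n _ n))) (coprime-1+⁻ c)))
  -- Below 1, the fraction is 1 / (1 + y) with y = (1 + k) / (1 + m).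
  ... | less m k = inv _ (subst P (1+mkℚ k m (coprime-1+⁻ (Coprimality.sym c)))
    (step _ (go k m (rs (+-comm-< m k (ℕ.m≤n+m _ m))) (coprime-1+⁻ (Coprimality.sym c)))))
  -- A number coprime to itself is 1; `recompute` turns the irrelevant coprimality proof into one
  -- that can be matched on.
  ... | equal m with refl ← Coprimality.recompute c (∣-refl , ∣-refl) = base

⟦⟧-injective : ∀ {a b} → ⟦ a ⟧ ≡ ⟦ b ⟧ → a ≡ b
⟦⟧-injective refl = refl

/-coprime : ∀ m n .(c : Coprime (suc m) (suc n)) →
            mkℕ⁺ (suc m) / mkℕ⁺ (suc n) ≡ mkℚ⁺ (mkℚ +[1+ m ] n c)
/-coprime m n c = value-injective (ℚ.normalize-coprime c)

1/-/ : ∀ a b → Coprime ⟦ a ⟧ ⟦ b ⟧ → 1/ (a / b) ≡ b / a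
1/-/ (mkℕ⁺ (suc m)) (mkℕ⁺ (suc n)) c =
  trans (cong 1/_ (/-coprime m n c)) (sym (/-coprime n m (Coprimality.sym c)))

1+-/ : ∀ a b → Coprime ⟦ a ⟧ ⟦ b ⟧ → 1ℚ⁺ + a / b ≡ (b +ℕ⁺ a) / b
1+-/ (mkℕ⁺ (suc m)) (mkℕ⁺ (suc n)) c = begin
  1ℚ⁺ + mkℕ⁺ (suc m) / mkℕ⁺ (suc n)            ≡⟨ cong (1ℚ⁺ +_) (/-coprime m n c) ⟩
  1ℚ⁺ + mkℚ⁺ (mkℚ +[1+ m ] n c)                ≡⟨ 1+mkℚ m n c ⟩
  mkℚ⁺ (mkℚ +[1+ suc (n ℕ.+ m) ] n _)          ≡⟨ /-coprime (suc (n ℕ.+ m)) n (coprime-1+ c) ⟨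
  mkℕ⁺ (suc (suc (n ℕ.+ m))) / mkℕ⁺ (suc n)    ≡⟨ cong (_/ mkℕ⁺ (suc n)) (⟦⟧-injective (cong suc (ℕ.+-suc n m))) ⟨
  mkℕ⁺ (suc n ℕ.+ suc m) / mkℕ⁺ (suc n)        ∎

-- On coprime pairs `_/_` cancels nothing, so numerator and denominator can be read off the
-- normalised rational.
/-injective : ∀ a b c d → Coprime ⟦ a ⟧ ⟦ b ⟧ → Coprime ⟦ c ⟧ ⟦ d ⟧ →
              a / b ≡ c / d → a ≡ c × b ≡ d
/-injective (mkℕ⁺ (suc k)) (mkℕ⁺ (suc l)) (mkℕ⁺ (suc m)) (mkℕ⁺ (suc n)) c₁ c₂ eq
  with refl , refl ← ℚ.mkℚ-injective (cong ℚ⁺.value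
         (trans (sym (/-coprime k l c₁)) (trans eq (/-coprime m n c₂))))
  = refl , refl

-- Residues and totatives

-- The representative of q modulo p in {1, …, p}, rather than in {0, …, p - 1}.

residue : ℕ⁺ → ℕ⁺ → ℕ
residue (mkℕ⁺ p) (mkℕ⁺ q) = suc (ℕ.pred q % p)

-- As q is positive, the predecessor of k p + q is k p plus the predecessor of q.
residue-+* : ∀ p k q q′ → ⟦ q′ ⟧ ≡ k ℕ.* ⟦ p ⟧ ℕ.+ ⟦ q ⟧ → residue p q′ ≡ residue p q
residue-+* (mkℕ⁺ p) k (mkℕ⁺ (suc q)) (mkℕ⁺ q′) eq = cong suc (begin
  ℕ.pred q′ % p        ≡⟨ cong (λ l → ℕ.pred l % p) (trans eq (ℕ.+-comm (k ℕ.* p) (suc q))) ⟩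
  (q ℕ.+ k ℕ.* p) % p  ≡⟨ [m+kn]%n≡m%n q k p ⟩
  q % p                ∎)

residue-spec : ∀ p q → ∃[ k ] k ℕ.* ⟦ p ⟧ ℕ.+ residue p q ≡ ⟦ q ⟧
residue-spec (mkℕ⁺ p) (mkℕ⁺ (suc q)) = q ℕ./ p ,
  trans (ℕ.+-comm (q ℕ./ p ℕ.* p) _) (cong suc (sym (m≡m%n+[m/n]*n q p)))

-- The length of this list is `φ p` by definition, so a bijection onto its positions needs no
-- further counting.
totatives : ℕ → List ℕ
totatives p = filter (λ k → coprime? k p) (applyUpTo suc p)

totatives-unique : ∀ p → Unique (totatives p)
totatives-unique p = filter⁺ (λ k → coprime? k p)
  (applyUpTo⁺₁ suc p λ i<j _ eq → ℕ.<⇒≢ i<j (ℕ.suc-injective eq))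

∈-totatives⁻ : ∀ p {k} → k ∈ totatives ⟦ p ⟧ →
               ∃[ q ] (Coprime ⟦ p ⟧ ⟦ q ⟧ × residue p q ≡ k)
∈-totatives⁻ (mkℕ⁺ p) k∈ with ∈-filter⁻ (λ k → coprime? k p) {xs = applyUpTo suc p} k∈
... | k∈′ , c with i , i<p , refl ← ∈-applyUpTo⁻ suc k∈′ =
  -- A member of {1, ..., p} is its own residue.
  mkℕ⁺ (suc i) , Coprimality.sym c , cong suc (m<n⇒m%n≡m i<p)

residue∈totatives : ∀ p q → Coprime ⟦ p ⟧ ⟦ q ⟧ → residue p q ∈ totatives ⟦ p ⟧
residue∈totatives p@(mkℕ⁺ n) q@(mkℕ⁺ m) c
  with k , eq ← residue-spec p q =
  ∈-filter⁺ (λ k → coprime? k n) (∈-applyUpTo⁺ suc (m%n<n (ℕ.pred m) n))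
    (coprime-∣+ (n∣m*n k) (subst (λ l → Coprime l n) (sym eq) (Coprimality.sym c)))

-- The involution J and the coordinates (`con x` , `den x`)

module Conumerator (con : ℚ⁺ → ℕ⁺) (isConumerator : IsConumerator con) where

  open IsConumerator isConumerator

  den : ℚ⁺ → ℕ⁺
  den x = con (1/ x)

  den-1/ : ∀ x → den (1/ x) ≡ con x
  den-1/ x = cong con (1/-involutive x)

  -- In the coordinates (p , q), x ↦ 1 + x acts as (p , q) ↦ (p + q , p) and inversion as a swap;
  -- both preserve coprimality.
  con-coprime-den : ∀ x → Coprime ⟦ con x ⟧ ⟦ den x ⟧
  con-coprime-den = ℚ⁺-induction _
    (subst (λ a → Coprime ⟦ a ⟧ ⟦ den 1ℚ⁺ ⟧) (sym con-1) (1-coprimeTo _))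
    (λ x c → subst₂ (λ a b → Coprime ⟦ a ⟧ ⟦ b ⟧) (sym (con-1+x x)) (sym (con-1/[1+x] x))
               (coprime-+ (Coprimality.sym c)))
    (λ x c → subst (λ a → Coprime ⟦ den x ⟧ ⟦ a ⟧) (sym (den-1/ x)) (Coprimality.sym c))

  J-1/ : ∀ x → J con (1/ x) ≡ 1/ J con x
  J-1/ x = begin
    den x / den (1/ x)  ≡⟨ cong (den x /_) (den-1/ x) ⟩
    den x / con x       ≡⟨ 1/-/ (con x) (den x) (con-coprime-den x) ⟨
    1/ J con x          ∎

  -- The inversion is kept inside `J` so that the equation can be applied again to its own
  -- right-hand side.
  J-1+ : ∀ x → J con (1ℚ⁺ + x) ≡ 1ℚ⁺ + J con (1/ x)
  J-1+ x = begin
    con (1ℚ⁺ + x) / den (1ℚ⁺ + x)  ≡⟨ cong₂ _/_ (con-1+x x) (con-1/[1+x] x) ⟩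
    (con x +ℕ⁺ den x) / con x      ≡⟨ 1+-/ (den x) (con x) (Coprimality.sym (con-coprime-den x)) ⟨
    1ℚ⁺ + den x / con x            ≡⟨ cong (λ a → 1ℚ⁺ + den x / a) (den-1/ x) ⟨
    1ℚ⁺ + J con (1/ x)             ∎

  -- Applying `J-1+` twice leaves two inversions around the inner `J`; they cancel because `J`
  -- commutes with inversion.
  J-involutive : ∀ x → J con (J con x) ≡ x
  J-involutive = ℚ⁺-induction _
    (trans (cong (J con) J-1) J-1)
    (λ x eq → begin
      J con (J con (1ℚ⁺ + x))            ≡⟨ cong (J con) (J-1+ x) ⟩
      J con (1ℚ⁺ + J con (1/ x))         ≡⟨ J-1+ (J con (1/ x)) ⟩
      1ℚ⁺ + J con (1/ J con (1/ x))      ≡⟨ cong (λ y → 1ℚ⁺ + J con y) (J-1/ (1/ x)) ⟨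
      1ℚ⁺ + J con (J con (1/ (1/ x)))    ≡⟨ cong (λ y → 1ℚ⁺ + J con (J con y)) (1/-involutive x) ⟩
      1ℚ⁺ + J con (J con x)              ≡⟨ cong (1ℚ⁺ +_) eq ⟩
      1ℚ⁺ + x                            ∎)
    (λ x eq → begin
      J con (J con (1/ x))  ≡⟨ cong (J con) (J-1/ x) ⟩
      J con (1/ J con x)    ≡⟨ J-1/ (J con x) ⟩
      1/ J con (J con x)    ≡⟨ cong 1/_ eq ⟩
      1/ x                  ∎)
    where
    J-1 : J con 1ℚ⁺ ≡ 1ℚ⁺
    J-1 = cong₂ _/_ con-1 con-1

  -- Put y = J (p / q). Then J y = p / q by involutivity, while J y is `con y / den y`; both
  -- fractions are reduced, so their entries agree.
  con,den-J : ∀ p q → Coprime ⟦ p ⟧ ⟦ q ⟧ → con (J con (p / q)) ≡ p × den (J con (p / q)) ≡ q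
  con,den-J p q c =
    /-injective _ _ p q (con-coprime-den _) c (J-involutive (p / q))

  con,den-injective : ∀ {x y} → con x ≡ con y → den x ≡ den y → x ≡ y
  con,den-injective {x} {y} con≡ den≡ = begin
    x                ≡⟨ J-involutive x ⟨
    J con (J con x)  ≡⟨ cong (J con) (cong₂ _/_ con≡ den≡) ⟩
    J con (J con y)  ≡⟨ J-involutive y ⟩
    y                ∎

  -- The action of T on the coordinates, and the fiber

  con-T^ : ∀ k x → con ((T ^ k) x) ≡ con x
  con-T^ zero    x = refl
  con-T^ (suc k) x = trans (con-1/[1+x] _) (con-T^ k x)

  -- Inverting T y gives 1 + y, so each application of `T` adds `con y` to the denominator, and
  -- `con y` remains p along the orbit.
  den-T^ : ∀ k {x p} → con x ≡ p → ⟦ den ((T ^ k) x) ⟧ ≡ k ℕ.* ⟦ p ⟧ ℕ.+ ⟦ den x ⟧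
  den-T^ zero            cx   = refl
  den-T^ (suc k) {x} {p} refl = begin
    ⟦ den (T y) ⟧                              ≡⟨ cong ⟦_⟧ (den-1/ (1ℚ⁺ + y)) ⟩
    ⟦ con (1ℚ⁺ + y) ⟧                          ≡⟨ cong ⟦_⟧ (con-1+x y) ⟩
    ⟦ con y ⟧ ℕ.+ ⟦ den y ⟧                    ≡⟨ cong₂ (λ a b → ⟦ a ⟧ ℕ.+ b) (con-T^ k x) (den-T^ k refl) ⟩
    ⟦ p ⟧ ℕ.+ (k ℕ.* ⟦ p ⟧ ℕ.+ ⟦ den x ⟧)      ≡⟨ ℕ.+-assoc ⟦ p ⟧ _ _ ⟨
    suc k ℕ.* ⟦ p ⟧ ℕ.+ ⟦ den x ⟧              ∎
    where
    y : ℚ⁺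
    y = (T ^ k) x

  fiber-J : ∀ p → Fiber con p ≐ (λ x → ∃[ q ] (gcd ⟦ p ⟧ ⟦ q ⟧ ≡ 1 × x ≡ J con (p / q)))
  fiber-J p =
      -- With q = `den x`, the fraction p / q is J x, and x = J (J x).
      (λ { {x} refl → den x , coprime⇒gcd≡1 (con-coprime-den x) , sym (J-involutive x) })
    , (λ { (q , gcd≡1 , refl) → proj₁ (con,den-J p q (gcd≡1⇒coprime gcd≡1)) })

  -- Counting the orbits in a fiber

  module _ (p : ℕ⁺) where

    open Setoid (FiberOrbits con p) using (_≈_) renaming (Carrier to FiberPoint)

    orbitResidue : FiberPoint → ℕ
    orbitResidue (x , _) = residue p (den x)

    orbitResidue-T^ : ∀ k {x y} → con x ≡ p → y ≡ (T ^ k) x →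
                      residue p (den y) ≡ residue p (den x)
    orbitResidue-T^ k {x} {y} cx refl = residue-+* p k (den x) (den y) (den-T^ k cx)

    orbitResidue-cong : ∀ x y → x ≈ y → orbitResidue x ≡ orbitResidue y
    orbitResidue-cong (_ , cx) _ (k , inj₁ eq) = sym (orbitResidue-T^ k cx eq)
    orbitResidue-cong _ (_ , cy) (k , inj₂ eq) = orbitResidue-T^ k cy eq

    -- If the denominators are k p + r and l p + r, then T^l and T^k move both
    -- points to the one with denominator (k + l) p + r.
    orbitResidue-injective : ∀ x y → orbitResidue x ≡ orbitResidue y → x ≈ y
    orbitResidue-injective (x , cx) (y , cy) eq
      with k , x≡ ← residue-spec p (den x) | l , y≡ ← residue-spec p (den y)
      = ∼-merge l k (con,den-injective
          (trans (con-T^ l x) (trans (trans cx (sym cy)) (sym (con-T^ k y))))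
          (⟦⟧-injective (begin
            ⟦ den ((T ^ l) x) ⟧                                  ≡⟨ den-T^ l cx ⟩
            l ℕ.* ⟦ p ⟧ ℕ.+ ⟦ den x ⟧                            ≡⟨ cong (l ℕ.* ⟦ p ⟧ ℕ.+_) x≡ ⟨
            l ℕ.* ⟦ p ⟧ ℕ.+ (k ℕ.* ⟦ p ⟧ ℕ.+ residue p (den x))  ≡⟨ x∙yz≈y∙xz (l ℕ.* ⟦ p ⟧) (k ℕ.* ⟦ p ⟧) _ ⟩
            k ℕ.* ⟦ p ⟧ ℕ.+ (l ℕ.* ⟦ p ⟧ ℕ.+ residue p (den x))  ≡⟨ cong (λ r → k ℕ.* ⟦ p ⟧ ℕ.+ (l ℕ.* ⟦ p ⟧ ℕ.+ r)) eq ⟩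
            k ℕ.* ⟦ p ⟧ ℕ.+ (l ℕ.* ⟦ p ⟧ ℕ.+ residue p (den y))  ≡⟨ cong (k ℕ.* ⟦ p ⟧ ℕ.+_) y≡ ⟩
            k ℕ.* ⟦ p ⟧ ℕ.+ ⟦ den y ⟧                            ≡⟨ den-T^ k cy ⟨
            ⟦ den ((T ^ k) y) ⟧                                  ∎)))

    orbitResidue-surjective : ∀ {r} → r ∈ totatives ⟦ p ⟧ → ∃[ x ] orbitResidue x ≡ r
    orbitResidue-surjective r∈ =
      let q , c , residue≡ = ∈-totatives⁻ p r∈
          con≡ , den≡      = con,den-J p q c
      -- The point J (p / q) has coordinates (p , q).
      in (J con (p / q) , con≡) , trans (cong (residue p) den≡) residue≡

    fiberOrbits-totatives : Bijection (FiberOrbits con p) (setoid (Fin (φ ⟦ p ⟧)))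
    fiberOrbits-totatives = classified-by-unique-list (FiberOrbits con p)
      (totatives-unique ⟦ p ⟧) orbitResidue
      (λ { (x , cx) → residue∈totatives p (den x)
        (subst (λ a → Coprime ⟦ a ⟧ ⟦ den x ⟧) cx (con-coprime-den x)) })
      orbitResidue-cong orbitResidue-injective orbitResidue-surjective

lemma4 : (con : ℚ⁺ → ℕ⁺) → IsConumerator con → (p : ℕ⁺) →
    (Fiber con p ≐ (λ x → ∃[ q ] (gcd ⟦ p ⟧ ⟦ q ⟧ ≡ 1 × x ≡ J con (p / q))))
    × Bijection (FiberOrbits con p) (setoid (Fin (φ ⟦ p ⟧)))
lemma4 con isCon p = fiber-J p , fiberOrbits-totatives p
  where open Conumerator con isCon
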